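{- Let $G$ be a simple connected graph. Then the following statements are equivalent: (i) $G\in\Gamma_{\leq 1}$, i.e. $\gamma(G)\le 1$; (ii) $G$ is $P_3$-free, i.e. no induced subgraph of $G$ is isomorphic to the path $P_3$ on three vertices; (iii) $G$ is a complete graph.
   Context: For a finite graph $G$ and indeterminates $X_G=\{x_u : u\in V(G)\}$, the generalized Laplacian matrix $L(G,X_G)$ is the $V(G)\times V(G)$ matrix over $\mathbb{Z}[X_G]$ whose $(u,u)$-entry is $x_u$ and whose $(u,v)$-entry for $u\neq v$ is $-m_{uv}$, where $m_{uv}$ is the number of edges between $u$ and $v$. For $1\le i\le |V(G)|$ the $i$-th critical ideal $I_i(G,X_G)$ is the ideal of $\mathbb{Z}[X_G]$ generated by all $i\times i$ minors of $L(G,X_G)$; by convention $I_i(G,X_G)=\langle 1\rangle$ for $i<1$ and $\langle 0\rangle$ for $i>|V(G)|$. The algebraic co-rank $\gamma(G)$ is the number of critical ideals of $G$ equal to $\langle 1\rangle$. $\Gamma_{\le k}$ denotes the set of simple connected graphs $G$ with $\gamma(G)\le k$. -}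

module Defs where

open import Algebra.Bundles using (CommutativeRing; CommutativeSemigroup; Semiring)
open import Algebra.Structures using (IsAbelianGroup; IsCommutativeMonoid)
open import Data.Bool.Base using (if_then_else_)
open import Data.Fin.Base using (Fin; zero; suc; toℕ; punchIn; _<_)
open import Data.Fin.Properties using (_≟_)
open import Data.Fin.Subset using (Subset; ∣_∣; _∈_)
open import Data.Integer.Base using (ℤ; +_)
import Data.Integer.Base as ℤ
open import Data.Integer.Properties using (+-*-commutativeRing)
open import Data.List.Base using (List; []; _∷_; map)
open import Data.Nat.Base as ℕ using (ℕ; zero; suc)
import Data.Nat.Properties as ℕₚ
open import Data.Product.Base using (Σ; Σ-syntax; ∃-syntax; _×_; _,_; proj₁)
open import Data.Unit.Base using (⊤)
open import Data.Vec.Functional using (Vector)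
open import Function.Bundles using (_⇔_; _↔_; module Inverse)
open import Level using (Level; 0ℓ; _⊔_)
open import Relation.Binary.Bundles using (Setoid)
open import Relation.Binary.Construct.Closure.ReflexiveTransitive using (Star)
open import Relation.Binary.Definitions using (Monotonic₁)
open import Relation.Binary.Structures using (IsEquivalence)
open import Relation.Binary.PropositionalEquality.Core using (_≡_; _≢_; refl; cong)
open import Relation.Nullary.Decidable.Core using (does)
open import Relation.Nullary.Negation.Core using (¬_)
open import Relation.Unary using (Pred; _≐_)

private
  variable
    b c ℓ : Level

-- A polynomial is its list of coefficients, constant term first.  Lists
-- are identified when all coefficients agree, so trailing zeros are
-- immaterial.
module Polynomial (R : CommutativeRing c ℓ) where

  open CommutativeRing R
    renaming (Carrier to A; refl to ≈-refl; sym to ≈-sym; trans to ≈-trans)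
  open import Algebra.Properties.AbelianGroup +-abelianGroup using (ε⁻¹≈ε)

  coeff : List A → ℕ → A
  coeff []      _       = 0#
  coeff (x ∷ p) zero    = x
  coeff (x ∷ p) (suc k) = coeff p k

  infix 4 _≋_
  record _≋_ (p q : List A) : Set ℓ where
    constructor mk≋
    field coeff-≈ : ∀ k → coeff p k ≈ coeff q k
  open _≋_ public

  infixl 6 _⊕_
  infixl 7 _⊛_ _·_
  infix  8 ⊝_

  _⊕_ : List A → List A → List A
  []      ⊕ q       = q
  (x ∷ p) ⊕ []      = x ∷ p
  (x ∷ p) ⊕ (y ∷ q) = x + y ∷ p ⊕ q

  ⊝_ : List A → List A
  ⊝_ = map (-_)

  _·_ : A → List A → List A
  x · p = map (x *_) p

  _⊛_ : List A → List A → List A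
  []      ⊛ q = []
  (x ∷ p) ⊛ q = x · q ⊕ (0# ∷ p ⊛ q)

  coeff-⊕ : ∀ p q k → coeff (p ⊕ q) k ≈ coeff p k + coeff q k
  coeff-⊕ []      q       k       = ≈-sym (+-identityˡ _)
  coeff-⊕ (x ∷ p) []      k       = ≈-sym (+-identityʳ _)
  coeff-⊕ (x ∷ p) (y ∷ q) zero    = ≈-refl
  coeff-⊕ (x ∷ p) (y ∷ q) (suc k) = coeff-⊕ p q k

  coeff-⊝ : ∀ p k → coeff (⊝ p) k ≈ - coeff p k
  coeff-⊝ []      k       = ≈-sym ε⁻¹≈ε
  coeff-⊝ (x ∷ p) zero    = ≈-refl
  coeff-⊝ (x ∷ p) (suc k) = coeff-⊝ p k

  coeff-· : ∀ x p k → coeff (x · p) k ≈ x * coeff p k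
  coeff-· x []      k       = ≈-sym (zeroʳ x)
  coeff-· x (y ∷ p) zero    = ≈-refl
  coeff-· x (y ∷ p) (suc k) = coeff-· x p k

  ≋-refl : ∀ {p} → p ≋ p
  ≋-refl = mk≋ λ k → ≈-refl

  ≋-sym : ∀ {p q} → p ≋ q → q ≋ p
  ≋-sym e = mk≋ λ k → ≈-sym (coeff-≈ e k)

  ≋-trans : ∀ {p q r} → p ≋ q → q ≋ r → p ≋ r
  ≋-trans e f = mk≋ λ k → ≈-trans (coeff-≈ e k) (coeff-≈ f k)

  ≋-isEquivalence : IsEquivalence _≋_
  ≋-isEquivalence = record { refl = ≋-refl ; sym = ≋-sym ; trans = ≋-trans }

  ≋-setoid : Setoid c ℓ
  ≋-setoid = record { isEquivalence = ≋-isEquivalence }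

  ∷-cong : ∀ {x y p q} → x ≈ y → p ≋ q → x ∷ p ≋ y ∷ q
  ∷-cong e f = mk≋ λ { zero → e ; (suc k) → coeff-≈ f k }

  0∷[] : 0# ∷ [] ≋ []
  0∷[] = mk≋ λ { zero → ≈-refl ; (suc k) → ≈-refl }

  ⊕-cong : ∀ {p p′ q q′} → p ≋ p′ → q ≋ q′ → p ⊕ q ≋ p′ ⊕ q′
  ⊕-cong {p} {p′} {q} {q′} e f = mk≋ λ k →
    ≈-trans (coeff-⊕ p q k)
      (≈-trans (+-cong (coeff-≈ e k) (coeff-≈ f k)) (≈-sym (coeff-⊕ p′ q′ k)))

  ⊕-assoc : ∀ p q r → (p ⊕ q) ⊕ r ≋ p ⊕ (q ⊕ r)
  ⊕-assoc []      q       r       = ≋-refl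
  ⊕-assoc (x ∷ p) []      r       = ≋-refl
  ⊕-assoc (x ∷ p) (y ∷ q) []      = ≋-refl
  ⊕-assoc (x ∷ p) (y ∷ q) (z ∷ r) = ∷-cong (+-assoc x y z) (⊕-assoc p q r)

  ⊕-comm : ∀ p q → p ⊕ q ≋ q ⊕ p
  ⊕-comm []      []      = ≋-refl
  ⊕-comm []      (y ∷ q) = ≋-refl
  ⊕-comm (x ∷ p) []      = ≋-refl
  ⊕-comm (x ∷ p) (y ∷ q) = ∷-cong (+-comm x y) (⊕-comm p q)

  ⊕-identityʳ : ∀ p → p ⊕ [] ≋ p
  ⊕-identityʳ p = ⊕-comm p []

  ⊝-cong : ∀ {p q} → p ≋ q → ⊝ p ≋ ⊝ q
  ⊝-cong {p} {q} e = mk≋ λ k →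
    ≈-trans (coeff-⊝ p k) (≈-trans (-‿cong (coeff-≈ e k)) (≈-sym (coeff-⊝ q k)))

  ⊝-inverseˡ : ∀ p → ⊝ p ⊕ p ≋ []
  ⊝-inverseˡ []      = ≋-refl
  ⊝-inverseˡ (x ∷ p) = ≋-trans (∷-cong (-‿inverseˡ x) (⊝-inverseˡ p)) 0∷[]

  ⊕-[]-isAbelianGroup : IsAbelianGroup _≋_ _⊕_ [] ⊝_
  ⊕-[]-isAbelianGroup = record
    { isGroup = record
      { isMonoid = record
        { isSemigroup = record
          { isMagma = record { isEquivalence = ≋-isEquivalence ; ∙-cong = ⊕-cong }
          ; assoc   = ⊕-assoc
          }
        ; identity = (λ p → ≋-refl) , ⊕-identityʳ
        }
      ; inverse = ⊝-inverseˡ , λ p → ≋-trans (⊕-comm p (⊝ p)) (⊝-inverseˡ p)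
      ; ⁻¹-cong = ⊝-cong
      }
    ; comm = ⊕-comm
    }

  private
    ⊕-semigroup : CommutativeSemigroup c ℓ
    ⊕-semigroup = record
      { isCommutativeSemigroup = IsCommutativeMonoid.isCommutativeSemigroup
          (IsAbelianGroup.isCommutativeMonoid ⊕-[]-isAbelianGroup) }

  open import Algebra.Properties.CommutativeSemigroup ⊕-semigroup
    using (interchange; x∙yz≈y∙xz)
  open import Relation.Binary.Reasoning.Setoid ≋-setoid

  ·-cong : ∀ {x y p q} → x ≈ y → p ≋ q → x · p ≋ y · q
  ·-cong {x} {y} {p} {q} e f = mk≋ λ k →
    ≈-trans (coeff-· x p k)
      (≈-trans (*-cong e (coeff-≈ f k)) (≈-sym (coeff-· y q k)))

  ·-distribʳ : ∀ x y p → (x + y) · p ≋ x · p ⊕ y · p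
  ·-distribʳ x y []      = ≋-refl
  ·-distribʳ x y (z ∷ p) = ∷-cong (distribʳ z x y) (·-distribʳ x y p)

  ·-distribˡ : ∀ x p q → x · (p ⊕ q) ≋ x · p ⊕ x · q
  ·-distribˡ x []      q       = ≋-refl
  ·-distribˡ x (y ∷ p) []      = ≋-refl
  ·-distribˡ x (y ∷ p) (z ∷ q) = ∷-cong (distribˡ x y z) (·-distribˡ x p q)

  ·-assoc : ∀ x y p → (x * y) · p ≋ x · (y · p)
  ·-assoc x y []      = ≋-refl
  ·-assoc x y (z ∷ p) = ∷-cong (*-assoc x y z) (·-assoc x y p)

  ·-identity : ∀ p → 1# · p ≋ p
  ·-identity []      = ≋-refl
  ·-identity (x ∷ p) = ∷-cong (*-identityˡ x) (·-identity p)

  ·-zero : ∀ p → 0# · p ≋ []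
  ·-zero []      = ≋-refl
  ·-zero (x ∷ p) = ≋-trans (∷-cong (zeroˡ x) (·-zero p)) 0∷[]

  0∷-⊕ : ∀ p q → (0# ∷ p) ⊕ (0# ∷ q) ≋ 0# ∷ p ⊕ q
  0∷-⊕ p q = ∷-cong (+-identityˡ 0#) ≋-refl

  ⊛-congˡ : ∀ p {q r} → q ≋ r → p ⊛ q ≋ p ⊛ r
  ⊛-congˡ []      e = ≋-refl
  ⊛-congˡ (x ∷ p) e = ⊕-cong (·-cong ≈-refl e) (∷-cong ≈-refl (⊛-congˡ p e))

  ⊛-zeroʳ : ∀ p → p ⊛ [] ≋ []
  ⊛-zeroʳ []      = ≋-refl
  ⊛-zeroʳ (x ∷ p) = ≋-trans (∷-cong ≈-refl (⊛-zeroʳ p)) 0∷[]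

  ⊛-∷ : ∀ p y q → p ⊛ (y ∷ q) ≋ y · p ⊕ (0# ∷ p ⊛ q)
  ⊛-∷ []      y q = ≋-sym 0∷[]
  ⊛-∷ (x ∷ p) y q = ∷-cong (+-cong (*-comm x y) ≈-refl) (begin
    x · q ⊕ p ⊛ (y ∷ q)            ≈⟨ ⊕-cong ≋-refl (⊛-∷ p y q) ⟩
    x · q ⊕ (y · p ⊕ (0# ∷ p ⊛ q)) ≈⟨ x∙yz≈y∙xz (x · q) (y · p) _ ⟩
    y · p ⊕ (x · q ⊕ (0# ∷ p ⊛ q)) ∎)

  ⊛-comm : ∀ p q → p ⊛ q ≋ q ⊛ p
  ⊛-comm []      q = ≋-sym (⊛-zeroʳ q)
  ⊛-comm (x ∷ p) q = begin
    x · q ⊕ (0# ∷ p ⊛ q) ≈⟨ ⊕-cong ≋-refl (∷-cong ≈-refl (⊛-comm p q)) ⟩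
    x · q ⊕ (0# ∷ q ⊛ p) ≈⟨ ⊛-∷ q x p ⟨
    q ⊛ (x ∷ p)          ∎

  ⊛-cong : ∀ {p p′ q q′} → p ≋ p′ → q ≋ q′ → p ⊛ q ≋ p′ ⊛ q′
  ⊛-cong {p} {p′} {q} {q′} e f = begin
    p ⊛ q   ≈⟨ ⊛-congˡ p f ⟩
    p ⊛ q′  ≈⟨ ⊛-comm p q′ ⟩
    q′ ⊛ p  ≈⟨ ⊛-congˡ q′ e ⟩
    q′ ⊛ p′ ≈⟨ ⊛-comm q′ p′ ⟩
    p′ ⊛ q′ ∎

  ⊛-distribʳ : ∀ r p q → (p ⊕ q) ⊛ r ≋ p ⊛ r ⊕ q ⊛ r
  ⊛-distribʳ r []      q       = ≋-refl
  ⊛-distribʳ r (x ∷ p) []      = ≋-sym (⊕-identityʳ _)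
  ⊛-distribʳ r (x ∷ p) (y ∷ q) = begin
    (x + y) · r ⊕ (0# ∷ (p ⊕ q) ⊛ r)
      ≈⟨ ⊕-cong (·-distribʳ x y r) (∷-cong ≈-refl (⊛-distribʳ r p q)) ⟩
    (x · r ⊕ y · r) ⊕ (0# ∷ p ⊛ r ⊕ q ⊛ r)
      ≈⟨ ⊕-cong ≋-refl (0∷-⊕ (p ⊛ r) (q ⊛ r)) ⟨
    (x · r ⊕ y · r) ⊕ ((0# ∷ p ⊛ r) ⊕ (0# ∷ q ⊛ r))
      ≈⟨ interchange (x · r) (y · r) (0# ∷ p ⊛ r) (0# ∷ q ⊛ r) ⟩
    (x · r ⊕ (0# ∷ p ⊛ r)) ⊕ (y · r ⊕ (0# ∷ q ⊛ r)) ∎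

  ⊛-distribˡ : ∀ r p q → r ⊛ (p ⊕ q) ≋ r ⊛ p ⊕ r ⊛ q
  ⊛-distribˡ r p q = begin
    r ⊛ (p ⊕ q)   ≈⟨ ⊛-comm r (p ⊕ q) ⟩
    (p ⊕ q) ⊛ r   ≈⟨ ⊛-distribʳ r p q ⟩
    p ⊛ r ⊕ q ⊛ r ≈⟨ ⊕-cong (⊛-comm p r) (⊛-comm q r) ⟩
    r ⊛ p ⊕ r ⊛ q ∎

  ·-⊛ : ∀ x p q → (x · p) ⊛ q ≋ x · (p ⊛ q)
  ·-⊛ x []      q = ≋-refl
  ·-⊛ x (y ∷ p) q = begin
    (x * y) · q ⊕ (0# ∷ (x · p) ⊛ q)
      ≈⟨ ⊕-cong (·-assoc x y q) (∷-cong (≈-sym (zeroʳ x)) (·-⊛ x p q)) ⟩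
    x · (y · q) ⊕ x · (0# ∷ p ⊛ q)
      ≈⟨ ·-distribˡ x (y · q) (0# ∷ p ⊛ q) ⟨
    x · (y · q ⊕ (0# ∷ p ⊛ q)) ∎

  ⊛-assoc : ∀ p q r → (p ⊛ q) ⊛ r ≋ p ⊛ (q ⊛ r)
  ⊛-assoc []      q r = ≋-refl
  ⊛-assoc (x ∷ p) q r = begin
    (x · q ⊕ (0# ∷ p ⊛ q)) ⊛ r
      ≈⟨ ⊛-distribʳ r (x · q) (0# ∷ p ⊛ q) ⟩
    (x · q) ⊛ r ⊕ (0# · r ⊕ (0# ∷ (p ⊛ q) ⊛ r))
      ≈⟨ ⊕-cong (·-⊛ x q r) (⊕-cong (·-zero r) (∷-cong ≈-refl (⊛-assoc p q r))) ⟩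
    x · (q ⊛ r) ⊕ (0# ∷ p ⊛ (q ⊛ r)) ∎

  ⊛-identityˡ : ∀ p → (1# ∷ []) ⊛ p ≋ p
  ⊛-identityˡ p = begin
    1# · p ⊕ (0# ∷ []) ≈⟨ ⊕-cong (·-identity p) 0∷[] ⟩
    p ⊕ []             ≈⟨ ⊕-identityʳ p ⟩
    p                  ∎

  commutativeRing : CommutativeRing c ℓ
  commutativeRing = record
    { Carrier = List A
    ; _≈_     = _≋_
    ; _+_     = _⊕_
    ; _*_     = _⊛_
    ; -_      = ⊝_
    ; 0#      = []
    ; 1#      = 1# ∷ []
    ; isCommutativeRing = record
      { isRing = record
        { +-isAbelianGroup = ⊕-[]-isAbelianGroup
        ; *-cong     = ⊛-cong
        ; *-assoc    = ⊛-assoc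
        ; *-identity = ⊛-identityˡ
                     , λ p → ≋-trans (⊛-comm p (1# ∷ [])) (⊛-identityˡ p)
        ; distrib    = ⊛-distribˡ , ⊛-distribʳ
        }
      ; *-comm = ⊛-comm
      }
    }

-- Outermost variable x₀: ℤ[x₀, …, xₙ] is ℤ[x₁, …, xₙ][x₀].
ℤ[x_] : ℕ → CommutativeRing 0ℓ 0ℓ
ℤ[x zero  ] = +-*-commutativeRing
ℤ[x suc n ] = Polynomial.commutativeRing ℤ[x n ]

const : ∀ n → ℤ → CommutativeRing.Carrier ℤ[x n ]
const zero    z = z
const (suc n) z = const n z ∷ []

var : ∀ {n} → Fin n → CommutativeRing.Carrier ℤ[x n ]
var {suc n} zero    = 0# ∷ 1# ∷ []  where open CommutativeRing ℤ[x n ]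
var {suc n} (suc i) = var i ∷ []

module LinearAlgebra (R : CommutativeRing c ℓ) where

  open CommutativeRing R hiding (zero) renaming (Carrier to A; _*_ to _∙_)
  open import Algebra.Definitions.RawSemiring (Semiring.rawSemiring semiring)
    using (sum; _^_)

  Matrix : ℕ → ℕ → Set c
  Matrix m n = Fin m → Fin n → A

  det : ∀ {n} → Matrix n n → A
  det {zero}  M = 1#
  det {suc n} M = sum λ j →
    (- 1#) ^ toℕ j ∙ M zero j ∙ det (λ r s → M (suc r) (punchIn j s))

  -- An i-element subset of Fin n, as its increasing enumeration.
  Choice : ℕ → ℕ → Set
  Choice i n = Σ[ f ∈ (Fin i → Fin n) ] Monotonic₁ _<_ _<_ f

  minor : ∀ {m n i} → Matrix m n → Choice i m × Choice i n → A
  minor M ((f , _) , (g , _)) = det λ r s → M (f r) (g s)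

  -- The ideal generated by a family of elements: all finite linear
  -- combinations.
  ⟨_⟩ : {J : Set b} → (J → A) → Pred A (b ⊔ c ⊔ ℓ)
  ⟨_⟩ {J = J} g p = ∃[ k ] Σ[ q ∈ Vector A k ] Σ[ j ∈ Vector J k ]
    p ≈ sum λ t → q t ∙ g (j t)

  ⟨1⟩ : Pred A (c ⊔ ℓ)
  ⟨1⟩ = ⟨ (λ (_ : ⊤) → 1#) ⟩

record Graph (V : Set) : Set where
  field
    edges     : V → V → ℕ
    edges-sym : ∀ u v → edges u v ≡ edges v u

  Adjacent : V → V → Set
  Adjacent u v = edges u v ≢ 0

open Graph public

private
  variable
    V W : Set
    n : ℕ

record Simple (G : Graph V) : Set where
  field
    loopless   : ∀ v → edges G v v ≡ 0
    noParallel : ∀ u v → edges G u v ℕ.≤ 1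

record Connected (G : Graph V) : Set where
  field
    nonEmpty : V
    walk     : ∀ u v → Star (Adjacent G) u v

Complete : Graph V → Set
Complete G = ∀ u v → u ≢ v → Adjacent G u v

infix 4 _≅_ _-Free_

_≅_ : Graph V → Graph W → Set
_≅_ {V} {W} G H = Σ[ φ ∈ V ↔ W ]
  (∀ u v → edges G u v ≡ edges H (Inverse.to φ u) (Inverse.to φ v))

induced : Graph (Fin n) → (S : Subset n) → Graph (Σ[ v ∈ Fin n ] v ∈ S)
induced G S = record
  { edges     = λ u v → edges G (proj₁ u) (proj₁ v)
  ; edges-sym = λ u v → edges-sym G (proj₁ u) (proj₁ v)
  }

path : ∀ n → Graph (Fin n)
path n = record
  { edges     = λ i j → adj ℕ.∣ toℕ i - toℕ j ∣
  ; edges-sym = λ i j → cong adj (ℕₚ.∣-∣-comm (toℕ i) (toℕ j))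
  }
  where
  adj : ℕ → ℕ
  adj d = if d ℕ.≡ᵇ 1 then 1 else 0

_-Free_ : ∀ {m} → Graph (Fin m) → Graph (Fin n) → Set
H -Free G = ¬ (∃[ S ] induced G S ≅ H)

module _ (G : Graph (Fin n)) where

  open LinearAlgebra ℤ[x n ]

  laplacian : Matrix n n
  laplacian u v =
    if does (u ≟ v) then var u else const n (ℤ.- (+ edges G u v))

  -- This yields ⟨1⟩ for i = 0 (the empty determinant is 1) and ⟨0⟩ for
  -- i > n (there are no minors).
  criticalIdeal : ℕ → Pred (CommutativeRing.Carrier ℤ[x n ]) 0ℓ
  criticalIdeal i = ⟨ minor {i = i} laplacian ⟩

  -- γ(G) = g.  Only the indices 1, …, n are counted, index i + 1 being
  -- represented by i : Fin n.  The co-rank is a relation because counting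
  -- requires deciding which ideals are trivial.
  AlgebraicCoRank : ℕ → Set
  AlgebraicCoRank g = Σ[ S ∈ Subset n ]
    (∀ i → i ∈ S ⇔ criticalIdeal (suc (toℕ i)) ≐ ⟨1⟩) × ∣ S ∣ ≡ g

record Γ≤ (k : ℕ) (G : Graph (Fin n)) : Set where
  field
    simple    : Simple G
    connected : Connected G
    coRank    : ∃[ g ] AlgebraicCoRank G g × g ℕ.≤ k

{-# OPTIONS --safe #-}
-- An induced path a – b – c makes the minor of L(G, X) on rows a, b and
-- columns b, c equal to ±1, and an edge makes a 1 × 1 minor equal to −1, so the
-- first two critical ideals are trivial.  Conversely, evaluating all variables
-- at −1 turns L(Kₙ, X) into a matrix with constant entries, whose minors of size
-- at least 2 vanish, so no critical ideal beyond the first contains 1; for K₁,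
-- evaluating at 0 excludes the first as well.  Finally, without an induced P₃
-- two successive edges of a walk can always be replaced by at most one.
module Submission where

open import Defs
open import Algebra.Bundles using (CommutativeRing; Semiring)
open import Algebra.Morphism.Construct.Identity using (isRingHomomorphism)
open import Algebra.Morphism.Structures using (module RingMorphisms)
open import Data.Fin.Base using (Fin; zero; suc; toℕ; punchIn; _<_)
open import Data.Fin.Patterns using (0F; 1F; 2F)
open import Data.Fin.Properties using (_≟_; any?; <-cmp)
open import Data.Fin.Subset using (Subset; inside; ∣_∣; _∈_)
  renaming (⊥ to ∅)
open import Data.Fin.Subset.Properties using (∣⊥∣≡0; ∉⊥)
open import Data.Integer.Base using (ℤ; +_; 0ℤ; -1ℤ)
import Data.Integer.Base as ℤ
import Data.Integer.Properties as ℤₚ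
open import Data.Integer.Properties using (+-*-commutativeRing)
open import Data.List.Base using (List; []; _∷_)
open import Data.Nat.Base as ℕ using (ℕ; zero; suc; z≤n; s≤s)
import Data.Nat.Properties as ℕₚ
open import Data.Product.Base using (Σ-syntax; ∃-syntax; _×_; _,_; proj₁; proj₂)
open import Data.Sum.Base using (_⊎_; inj₁; inj₂)
open import Data.Unit.Base using (tt)
open import Data.Vec.Base using (_∷_; tabulate; here; there)
open import Data.Vec.Properties using (lookup∘tabulate; lookup⇒[]=; []=⇒lookup)
open import Data.Vec.Properties.WithK using ([]=-irrelevant)
open import Function.Base using (_∘_; id)
open import Function.Bundles using (_⇔_; mk⇔; mk↔ₛ′; module Inverse; module Equivalence)
open import Function.Definitions using (Injective)
open import Level using (Level)
open import Relation.Binary.Construct.Closure.ReflexiveTransitive using (Star; ε; _◅_)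
open import Relation.Binary.Definitions using (tri<; tri≈; tri>)
open import Relation.Binary.PropositionalEquality
  using (_≡_; _≢_; refl; sym; trans; cong; cong₂; subst; module ≡-Reasoning)
open import Relation.Nullary.Decidable using (dec-true)
open import Relation.Nullary.Decidable.Core using (Dec; yes; no; does)
open import Relation.Nullary.Negation.Core using (¬_; contradiction)
open import Relation.Unary using (_≐_)

private
  variable
    a c ℓ c′ ℓ′ : Level
    m n : ℕ

-- Evaluation of one-variable polynomials.

IsRingHom : (R : CommutativeRing c ℓ) (S : CommutativeRing c′ ℓ′) →
  (CommutativeRing.Carrier R → CommutativeRing.Carrier S) → Set _
IsRingHom R S = RingMorphisms.IsRingHomomorphism
  (CommutativeRing.rawRing R) (CommutativeRing.rawRing S)

module PolynomialEvaluation (R : CommutativeRing c ℓ) (S : CommutativeRing c′ ℓ′)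
  {⟦_⟧ : CommutativeRing.Carrier R → CommutativeRing.Carrier S}
  (hom : IsRingHom R S ⟦_⟧) (s : CommutativeRing.Carrier S) where

  private
    module R = CommutativeRing R
    module ⟦⟧ = RingMorphisms.IsRingHomomorphism hom
  open Polynomial R
  open CommutativeRing S
    renaming (Carrier to B; refl to ≈-refl; sym to ≈-sym; trans to ≈-trans)
  open import Algebra.Properties.Ring ring
  open import Algebra.Properties.CommutativeSemigroup
    (CommutativeRing.+-commutativeSemigroup S) using (interchange)
  import Algebra.Properties.CommutativeSemigroup
    (CommutativeRing.*-commutativeSemigroup S) as *
  open import Relation.Binary.Reasoning.Setoid setoid

  -- Horner's scheme at `s`, with coefficients carried along `⟦_⟧`. Allowing an arbitrary
  -- homomorphism on the coefficients makes it possible to iterate the construction over several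
  -- variables.
  eval : List R.Carrier → B
  eval []      = 0#
  eval (x ∷ p) = ⟦ x ⟧ + s * eval p

  -- A list equal to `[]` may still consist of any number of zeros. This absorbs the trailing zeros
  -- left over when `eval-cong` compares lists of different lengths.
  eval-zero : ∀ p → p ≋ [] → eval p ≈ 0#
  eval-zero []      e = ≈-refl
  eval-zero (x ∷ p) e = begin
    ⟦ x ⟧ + s * eval p ≈⟨ +-cong (⟦⟧.⟦⟧-cong (coeff-≈ e 0)) (*-congˡ (eval-zero p (mk≋ (coeff-≈ e ∘ suc)))) ⟩
    ⟦ R.0# ⟧ + s * 0#  ≈⟨ +-cong ⟦⟧.0#-homo (zeroʳ s) ⟩
    0# + 0#            ≈⟨ +-identityˡ 0# ⟩
    0#                 ∎

  eval-cong : ∀ {p q} → p ≋ q → eval p ≈ eval q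
  eval-cong {[]}    {q}     e = ≈-sym (eval-zero q (≋-sym e))
  eval-cong {x ∷ p} {[]}    e = eval-zero (x ∷ p) e
  eval-cong {x ∷ p} {y ∷ q} e =
    +-cong (⟦⟧.⟦⟧-cong (coeff-≈ e 0)) (*-congˡ (eval-cong {p} {q} (mk≋ (coeff-≈ e ∘ suc))))

  eval-⊕ : ∀ p q → eval (p ⊕ q) ≈ eval p + eval q
  eval-⊕ []      q       = ≈-sym (+-identityˡ _)
  eval-⊕ (x ∷ p) []      = ≈-sym (+-identityʳ _)
  eval-⊕ (x ∷ p) (y ∷ q) = begin
    ⟦ x R.+ y ⟧ + s * eval (p ⊕ q)                ≈⟨ +-cong (⟦⟧.+-homo x y) (*-congˡ (eval-⊕ p q)) ⟩
    (⟦ x ⟧ + ⟦ y ⟧) + s * (eval p + eval q)       ≈⟨ +-congˡ (distribˡ s _ _) ⟩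
    (⟦ x ⟧ + ⟦ y ⟧) + (s * eval p + s * eval q)   ≈⟨ interchange _ _ _ _ ⟩
    (⟦ x ⟧ + s * eval p) + (⟦ y ⟧ + s * eval q)   ∎

  eval-⊝ : ∀ p → eval (⊝ p) ≈ - eval p
  eval-⊝ []      = ≈-sym -0#≈0#
  eval-⊝ (x ∷ p) = begin
    ⟦ R.- x ⟧ + s * eval (⊝ p) ≈⟨ +-cong (⟦⟧.-‿homo x) (*-congˡ (eval-⊝ p)) ⟩
    - ⟦ x ⟧ + s * - eval p     ≈⟨ +-congˡ (-‿distribʳ-* s _) ⟨
    - ⟦ x ⟧ + - (s * eval p)   ≈⟨ -‿+-comm _ _ ⟩
    - (⟦ x ⟧ + s * eval p)     ∎

  eval-· : ∀ x p → eval (x · p) ≈ ⟦ x ⟧ * eval p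
  eval-· x []      = ≈-sym (zeroʳ _)
  eval-· x (y ∷ p) = begin
    ⟦ x R.* y ⟧ + s * eval (x · p)          ≈⟨ +-cong (⟦⟧.*-homo x y) (*-congˡ (eval-· x p)) ⟩
    ⟦ x ⟧ * ⟦ y ⟧ + s * (⟦ x ⟧ * eval p)    ≈⟨ +-congˡ (*.x∙yz≈y∙xz _ _ _) ⟩
    ⟦ x ⟧ * ⟦ y ⟧ + ⟦ x ⟧ * (s * eval p)    ≈⟨ distribˡ _ _ _ ⟨
    ⟦ x ⟧ * (⟦ y ⟧ + s * eval p)            ∎

  eval-⊛ : ∀ p q → eval (p ⊛ q) ≈ eval p * eval q
  eval-⊛ []      q = ≈-sym (zeroˡ _)
  eval-⊛ (x ∷ p) q = begin
    eval (x · q ⊕ (R.0# ∷ p ⊛ q))                     ≈⟨ eval-⊕ (x · q) _ ⟩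
    eval (x · q) + (⟦ R.0# ⟧ + s * eval (p ⊛ q))      ≈⟨ +-cong (eval-· x q) (+-cong ⟦⟧.0#-homo (*-congˡ (eval-⊛ p q))) ⟩
    ⟦ x ⟧ * eval q + (0# + s * (eval p * eval q))     ≈⟨ +-congˡ (+-identityˡ _) ⟩
    ⟦ x ⟧ * eval q + s * (eval p * eval q)            ≈⟨ +-congˡ (*-assoc _ _ _) ⟨
    ⟦ x ⟧ * eval q + s * eval p * eval q              ≈⟨ distribʳ _ _ _ ⟨
    (⟦ x ⟧ + s * eval p) * eval q                     ∎

  eval-∷[] : ∀ x → eval (x ∷ []) ≈ ⟦ x ⟧
  eval-∷[] x = ≈-trans (+-congˡ (zeroʳ s)) (+-identityʳ _)

  eval-isRingHom : IsRingHom commutativeRing S eval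
  eval-isRingHom = record
    { isSemiringHomomorphism = record
      { isNearSemiringHomomorphism = record
        { +-isMonoidHomomorphism = record
          { isMagmaHomomorphism = record
            { isRelHomomorphism = record { cong = eval-cong }
            ; homo = eval-⊕
            }
          ; ε-homo = ≈-refl
          }
        ; *-homo = eval-⊛
        }
      ; 1#-homo = ≈-trans (eval-∷[] R.1#) ⟦⟧.1#-homo
      }
    ; -‿homo = eval-⊝
    }

-- Small determinants, minors and trivial ideals.

module DeterminantProperties (R : CommutativeRing c ℓ) where

  open LinearAlgebra R
  open CommutativeRing R hiding (zero)
    renaming (Carrier to A; refl to ≈-refl; sym to ≈-sym; trans to ≈-trans)
  open import Algebra.Properties.Ring ring
  open import Algebra.Definitions.RawSemiring (Semiring.rawSemiring semiring) using (_^_)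
  open import Algebra.Properties.Monoid.Sum +-monoid using (sum-cong-≋; sum-replicate-zero)
  open import Relation.Binary.Reasoning.Setoid setoid

  det₁ : (M : Matrix 1 1) → det M ≈ M 0F 0F
  det₁ M = begin
    1# * M 0F 0F * 1# + 0# ≈⟨ +-identityʳ _ ⟩
    1# * M 0F 0F * 1#      ≈⟨ *-identityʳ _ ⟩
    1# * M 0F 0F           ≈⟨ *-identityˡ _ ⟩
    M 0F 0F                ∎

  det₂ : (M : Matrix 2 2) → det M ≈ M 0F 0F * M 1F 1F - M 0F 1F * M 1F 0F
  det₂ M = begin
    1# * x₀₀ * det (λ r s → M (suc r) (punchIn 0F s)) +
      (- 1# * 1# * x₀₁ * det (λ r s → M (suc r) (punchIn 1F s)) + 0#)
      ≈⟨ +-cong (*-cong (*-identityˡ x₀₀) (det₁ λ r s → M (suc r) (punchIn 0F s)))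
           (≈-trans (+-identityʳ _) (*-cong (*-congʳ (*-identityʳ (- 1#)))
             (det₁ λ r s → M (suc r) (punchIn 1F s)))) ⟩
    x₀₀ * x₁₁ + - 1# * x₀₁ * x₁₀  ≈⟨ +-congˡ (*-congʳ (-1*x≈-x x₀₁)) ⟩
    x₀₀ * x₁₁ + - x₀₁ * x₁₀       ≈⟨ +-congˡ (-‿distribˡ-* x₀₁ x₁₀) ⟨
    x₀₀ * x₁₁ - x₀₁ * x₁₀         ∎
    where
    x₀₀ = M 0F 0F
    x₀₁ = M 0F 1F
    x₁₁ = M 1F 1F
    x₁₀ = M 1F 0F

  -- Deleting a row and a column leaves a constant matrix, so in the expansion along the first row
  -- every cofactor vanishes by induction. The induction starts at size 2, where the two products
  -- cancel; a 1 × 1 matrix would not do.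
  det-constant : ∀ {x} (M : Matrix (2 ℕ.+ n) (2 ℕ.+ n)) →
    (∀ r s → M r s ≈ x) → det M ≈ 0#
  det-constant {n = zero} {x} M M≈x = begin
    det M                                   ≈⟨ det₂ M ⟩
    M 0F 0F * M 1F 1F - M 0F 1F * M 1F 0F   ≈⟨ +-cong (*-cong (M≈x _ _) (M≈x _ _))
                                                 (-‿cong (*-cong (M≈x _ _) (M≈x _ _))) ⟩
    x * x - x * x                           ≈⟨ -‿inverseʳ _ ⟩
    0#                                      ∎
  det-constant {n = suc n} M M≈x = ≈-trans
    (sum-cong-≋ λ j → ≈-trans
      (*-congˡ (det-constant {n = n} (λ r s → M (suc r) (punchIn j s)) (λ _ _ → M≈x _ _)))
      (zeroʳ ((- 1#) ^ toℕ j * M zero j)))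
    (sum-replicate-zero (3 ℕ.+ n))

  -- A generator with inverse `q` suffices: any `p` is the single-term combination `p * q` times
  -- that generator.
  ⟨⟩≐⟨1⟩ : {J : Set a} (g : J → A) (j : J) (q : A) → q * g j ≈ 1# → ⟨ g ⟩ ≐ ⟨1⟩
  ⟨⟩≐⟨1⟩ g j q q*g≈1 =
      (λ {p} _ → 1 , (λ _ → p) , (λ _ → tt) , ≈-sym (≈-trans (+-identityʳ _) (*-identityʳ p)))
    , (λ {p} _ → 1 , (λ _ → p * q) , (λ _ → j) , (begin
        p                  ≈⟨ *-identityʳ p ⟨
        p * 1#             ≈⟨ *-congˡ q*g≈1 ⟨
        p * (q * g j)      ≈⟨ *-assoc p q (g j) ⟨
        p * q * g j        ≈⟨ +-identityʳ _ ⟨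
        p * q * g j + 0#   ∎))

  1∈⟨1⟩ : ⟨1⟩ 1#
  1∈⟨1⟩ = 1 , (λ _ → 1#) , (λ _ → tt) , ≈-sym (≈-trans (+-identityʳ _) (*-identityʳ 1#))

  choice₁ : Fin n → Choice 1 n
  choice₁ u = (λ _ → u) , λ { {0F} {0F} () }

  choice₂ : ∀ {u v : Fin n} → u < v → Choice 2 n
  choice₂ {u = u} {v} u<v = (λ { 0F → u ; 1F → v }) , λ
    { {0F} {0F} () ; {0F} {1F} _ → u<v ; {1F} {0F} () ; {1F} {1F} (s≤s ()) }

  minor-choice₁ : (M : Matrix m n) (u : Fin m) (v : Fin n) →
    minor M (choice₁ u , choice₁ v) ≈ M u v
  minor-choice₁ M u v = det₁ λ _ _ → M u v

  minor-choice₂ : (M : Matrix m n) → ∀ {u v w z} (u<v : u < v) (w<z : w < z) →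
    minor M (choice₂ u<v , choice₂ w<z) ≈ M u w * M v z - M u z * M v w
  minor-choice₂ M u<v w<z = det₂ λ r s → M (proj₁ (choice₂ u<v) r) (proj₁ (choice₂ w<z) s)

  -- The order-sensitive notion of choice forces a sign for unsorted rows and
  -- columns.
  minor₂ : (M : Matrix m n) → ∀ {u v w z} → u ≢ v → w ≢ z →
    ∃[ j ] Σ[ q ∈ A ] q * minor {i = 2} M j ≈ M u w * M v z - M u z * M v w
  minor₂ M {u} {v} {w} {z} u≢v w≢z with <-cmp u v | <-cmp w z
  ... | tri≈ _ u≡v _ | _            = contradiction u≡v u≢v
  ... | _            | tri≈ _ w≡z _ = contradiction w≡z w≢z
  ... | tri< u<v _ _ | tri< w<z _ _ = (choice₂ u<v , choice₂ w<z) , 1# ,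
    ≈-trans (*-identityˡ _) (minor-choice₂ M u<v w<z)
  ... | tri> _ _ v<u | tri> _ _ z<w = (choice₂ v<u , choice₂ z<w) , 1# , (begin
    1# * minor M (choice₂ v<u , choice₂ z<w) ≈⟨ *-identityˡ _ ⟩
    minor M (choice₂ v<u , choice₂ z<w)      ≈⟨ minor-choice₂ M v<u z<w ⟩
    M v z * M u w - M v w * M u z            ≈⟨ +-cong (*-comm _ _) (-‿cong (*-comm _ _)) ⟩
    M u w * M v z - M u z * M v w            ∎)
  ... | tri< u<v _ _ | tri> _ _ z<w = (choice₂ u<v , choice₂ z<w) , - 1# , (begin
    - 1# * minor M (choice₂ u<v , choice₂ z<w) ≈⟨ -1*x≈-x _ ⟩
    - minor M (choice₂ u<v , choice₂ z<w)      ≈⟨ -‿cong (minor-choice₂ M u<v z<w) ⟩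
    - (M u z * M v w - M u w * M v z)          ≈⟨ ⁻¹-anti-homo‿- _ _ ⟩
    M u w * M v z - M u z * M v w              ∎)
  ... | tri> _ _ v<u | tri< w<z _ _ = (choice₂ v<u , choice₂ w<z) , - 1# , (begin
    - 1# * minor M (choice₂ v<u , choice₂ w<z) ≈⟨ -1*x≈-x _ ⟩
    - minor M (choice₂ v<u , choice₂ w<z)      ≈⟨ -‿cong (minor-choice₂ M v<u w<z) ⟩
    - (M v w * M u z - M v z * M u w)          ≈⟨ ⁻¹-anti-homo‿- _ _ ⟩
    M v z * M u w - M v w * M u z              ≈⟨ +-cong (*-comm _ _) (-‿cong (*-comm _ _)) ⟩
    M u w * M v z - M u z * M v w              ∎)

-- Determinants and ideals under ring homomorphisms.

module DeterminantHomomorphism (R : CommutativeRing c ℓ) (S : CommutativeRing c′ ℓ′)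
  {⟦_⟧ : CommutativeRing.Carrier R → CommutativeRing.Carrier S}
  (hom : IsRingHom R S ⟦_⟧) where

  private
    module R where
      open CommutativeRing R public
      open LinearAlgebra R public
      open DeterminantProperties R public
      open import Algebra.Definitions.RawSemiring
        (Semiring.rawSemiring (CommutativeRing.semiring R)) public using (sum; _^_)
    module S = LinearAlgebra S
    module ⟦⟧ = RingMorphisms.IsRingHomomorphism hom
  open CommutativeRing S hiding (zero) renaming (refl to ≈-refl; sym to ≈-sym; trans to ≈-trans)
  open import Algebra.Definitions.RawSemiring (Semiring.rawSemiring semiring) using (_^_)
  open import Algebra.Properties.Monoid.Sum +-monoid
    using (sum; sum-cong-≋; sum-replicate-zero)
  open import Relation.Binary.Reasoning.Setoid setoid

  ^-homo : ∀ x k → ⟦ x R.^ k ⟧ ≈ ⟦ x ⟧ ^ k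
  ^-homo x zero    = ⟦⟧.1#-homo
  ^-homo x (suc k) = ≈-trans (⟦⟧.*-homo _ _) (*-congˡ (^-homo x k))

  sum-homo : ∀ {k} (t : Fin k → R.Carrier) → ⟦ R.sum t ⟧ ≈ sum (⟦_⟧ ∘ t)
  sum-homo {zero}  t = ⟦⟧.0#-homo
  sum-homo {suc k} t = ≈-trans (⟦⟧.+-homo _ _) (+-congˡ (sum-homo (t ∘ suc)))

  ^-congˡ : ∀ {x y} k → x ≈ y → x ^ k ≈ y ^ k
  ^-congˡ zero    e = ≈-refl
  ^-congˡ (suc k) e = *-cong e (^-congˡ k e)

  det-homo : (M : R.Matrix n n) → ⟦ R.det M ⟧ ≈ S.det (λ r s → ⟦ M r s ⟧)
  det-homo {zero}  M = ⟦⟧.1#-homo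
  det-homo {suc n} M = ≈-trans (sum-homo term) (sum-cong-≋ λ j → begin
    ⟦ term j ⟧
      ≈⟨ ⟦⟧.*-homo _ _ ⟩
    ⟦ (R.- R.1#) R.^ toℕ j R.* M zero j ⟧ * ⟦ R.det (cofactor j) ⟧
      ≈⟨ *-cong (⟦⟧.*-homo _ _) (det-homo (cofactor j)) ⟩
    ⟦ (R.- R.1#) R.^ toℕ j ⟧ * ⟦ M zero j ⟧ * S.det (λ r s → ⟦ cofactor j r s ⟧)
      ≈⟨ *-congʳ (*-congʳ (^-homo (R.- R.1#) (toℕ j))) ⟩
    ⟦ R.- R.1# ⟧ ^ toℕ j * ⟦ M zero j ⟧ * S.det (λ r s → ⟦ cofactor j r s ⟧)
      ≈⟨ *-congʳ (*-congʳ (^-congˡ (toℕ j) (≈-trans (⟦⟧.-‿homo _) (-‿cong ⟦⟧.1#-homo)))) ⟩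
    (- 1#) ^ toℕ j * ⟦ M zero j ⟧ * S.det (λ r s → ⟦ cofactor j r s ⟧)
      ∎)
    where
    cofactor : Fin (suc n) → R.Matrix n n
    cofactor j r s = M (suc r) (punchIn j s)
    term : Fin (suc n) → R.Carrier
    term j = (R.- R.1#) R.^ toℕ j R.* M zero j R.* R.det (cofactor j)

  -- If 1 is a combination of the generators, its image is a combination of zeros. Over a nontrivial
  -- target this refutes triviality of the ideal.
  ⟨⟩≐⟨1⟩⇒0≈1 : {J : Set a} (g : J → R.Carrier) → (∀ j → ⟦ g j ⟧ ≈ 0#) →
    R.⟨ g ⟩ ≐ R.⟨1⟩ → 0# ≈ 1#
  ⟨⟩≐⟨1⟩⇒0≈1 g g≈0 (_ , ⟨1⟩⊆⟨g⟩) with ⟨1⟩⊆⟨g⟩ R.1∈⟨1⟩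
  ... | k , q , j , 1≈∑ = begin
    0#                                ≈⟨ sum-replicate-zero k ⟨
    sum {k} (λ _ → 0#)                ≈⟨ sum-cong-≋ (λ t → ≈-trans (*-congˡ (g≈0 (j t))) (zeroʳ _)) ⟨
    sum (λ t → ⟦ q t ⟧ * ⟦ g (j t) ⟧) ≈⟨ sum-cong-≋ (λ t → ⟦⟧.*-homo (q t) (g (j t))) ⟨
    sum (λ t → ⟦ q t R.* g (j t) ⟧)   ≈⟨ sum-homo (λ t → q t R.* g (j t)) ⟨
    ⟦ R.sum (λ t → q t R.* g (j t)) ⟧ ≈⟨ ⟦⟧.⟦⟧-cong 1≈∑ ⟨
    ⟦ R.1# ⟧                          ≈⟨ ⟦⟧.1#-homo ⟩
    1#                                ∎

-- Induced subgraphs as embeddings.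

infix 4 _↪_

-- Multiplicities are preserved exactly, so non-edges are reflected too and the image is an induced
-- copy of `H`. This form avoids vertices paired with membership proofs.
_↪_ : Graph (Fin m) → Graph (Fin n) → Set
_↪_ {m} {n} H G = Σ[ f ∈ (Fin m → Fin n) ] Injective _≡_ _≡_ f ×
  (∀ i j → edges G (f i) (f j) ≡ edges H i j)

separate : ∀ {P : Fin n → Set} → (∀ x → Dec (P x)) → Subset n
separate P? = tabulate (does ∘ P?)

∈-separate⁺ : ∀ {P : Fin n → Set} (P? : ∀ x → Dec (P x)) {x} → P x → x ∈ separate P?
∈-separate⁺ P? {x} px =
  lookup⇒[]= x _ (trans (lookup∘tabulate _ x) (dec-true (P? x) px))

∈-separate⁻ : ∀ {P : Fin n → Set} (P? : ∀ x → Dec (P x)) {x} → x ∈ separate P? → P x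
∈-separate⁻ P? {x} x∈ with P? x | trans (sym (lookup∘tabulate (does ∘ P?) x)) ([]=⇒lookup x∈)
-- In the `no` case the abstracted equation would identify `false` with `inside`, so that case is
-- absent.
... | yes px | _ = px

-- Membership proofs are unique, so a vertex of an induced subgraph is determined by its underlying
-- vertex.
∈-Σ-≡ : {S : Subset n} {p q : Σ[ v ∈ Fin n ] v ∈ S} → proj₁ p ≡ proj₁ q → p ≡ q
∈-Σ-≡ {p = v , v∈S} {q = .v , v∈S′} refl = cong (v ,_) ([]=-irrelevant v∈S v∈S′)

-- The subset is the image of `f`. Membership in it is decided by searching the finite domain, and
-- the preimage found there defines the inverse map.
↪⇒induced : (H : Graph (Fin m)) (G : Graph (Fin n)) → H ↪ G → ∃[ S ] induced G S ≅ H
↪⇒induced {m} {n} H G (f , f-inj , f-edges) = S , mk↔ₛ′ to from to∘from from∘to ,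
  λ u v → trans (cong₂ (edges G) (sym (f∘to u)) (sym (f∘to v))) (f-edges (to u) (to v))
  where
  image? : ∀ v → Dec (∃[ i ] f i ≡ v)
  image? v = any? λ i → f i ≟ v
  S = separate image?
  to : Σ[ v ∈ Fin n ] v ∈ S → Fin m
  to (v , v∈S) = proj₁ (∈-separate⁻ image? v∈S)
  f∘to : ∀ v → f (to v) ≡ proj₁ v
  f∘to (v , v∈S) = proj₂ (∈-separate⁻ image? v∈S)
  from : Fin m → Σ[ v ∈ Fin n ] v ∈ S
  from i = f i , ∈-separate⁺ image? (i , refl)
  to∘from : ∀ i → to (from i) ≡ i
  to∘from i = f-inj (f∘to (from i))
  from∘to : ∀ v → from (to v) ≡ v
  from∘to v = ∈-Σ-≡ (f∘to v)

-- The embedding is the inverse of the isomorphism followed by the inclusion of `S`.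
induced⇒↪ : (H : Graph (Fin m)) (G : Graph (Fin n)) → ∃[ S ] induced G S ≅ H → H ↪ G
induced⇒↪ H G (S , φ , φ-edges) =
    proj₁ ∘ from
  , (λ {i} {j} e → trans (sym (strictlyInverseˡ i))
      (trans (cong to (∈-Σ-≡ e)) (strictlyInverseˡ j)))
  , λ i j → trans (φ-edges (from i) (from j))
      (cong₂ (edges H) (strictlyInverseˡ i) (strictlyInverseˡ j))
  where open Inverse φ

-- Evaluation of integer polynomials in several variables.

const-0 : ∀ n → let open CommutativeRing ℤ[x n ] in const n 0ℤ ≈ 0#
const-0 zero    = refl
-- Here `const` gives a one-element list while zero is `[]`; they agree only up to a trailing zero.
const-0 (suc n) = ≋-trans (∷-cong (const-0 n) ≋-refl) 0∷[]
  where open Polynomial ℤ[x n ]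

const--1 : ∀ n → let open CommutativeRing ℤ[x n ] in const n -1ℤ ≈ - 1#
const--1 zero    = refl
const--1 (suc n) = ∷-cong (const--1 n) ≋-refl
  where open Polynomial ℤ[x n ]

-- Mutual with its homomorphism proof: evaluating the outermost variable at `a zero` takes as
-- argument the homomorphism that evaluates the remaining ones.
evaluate : ∀ n → (Fin n → ℤ) → CommutativeRing.Carrier ℤ[x n ] → ℤ
evaluate-isRingHom : ∀ n (a : Fin n → ℤ) → IsRingHom ℤ[x n ] +-*-commutativeRing (evaluate n a)

evaluate zero    a = id
evaluate (suc n) a = PolynomialEvaluation.eval ℤ[x n ] +-*-commutativeRing (evaluate-isRingHom n (a ∘ suc)) (a zero)

evaluate-isRingHom zero    a = isRingHomomorphism _ refl
evaluate-isRingHom (suc n) a =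
  PolynomialEvaluation.eval-isRingHom ℤ[x n ] +-*-commutativeRing (evaluate-isRingHom n (a ∘ suc)) (a zero)

evaluate-const : ∀ n a z → evaluate n a (const n z) ≡ z
evaluate-const zero    a z = refl
evaluate-const (suc n) a z = trans
  (PolynomialEvaluation.eval-∷[] ℤ[x n ] +-*-commutativeRing (evaluate-isRingHom n (a ∘ suc)) (a zero) (const n z))
  (evaluate-const n (a ∘ suc) z)

evaluate-var : ∀ {n} a (i : Fin n) → evaluate n a (var i) ≡ a i
evaluate-var {suc n} a zero = begin
  ⟦ 0# ⟧ ℤ.+ a zero ℤ.* eval (1# ∷ []) ≡⟨ cong₂ ℤ._+_ ⟦⟧.0#-homo (cong (a zero ℤ.*_) (trans (eval-∷[] 1#) ⟦⟧.1#-homo)) ⟩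
  0ℤ ℤ.+ a zero ℤ.* ℤ.1ℤ               ≡⟨ ℤₚ.+-identityˡ _ ⟩
  a zero ℤ.* ℤ.1ℤ                      ≡⟨ ℤₚ.*-identityʳ _ ⟩
  a zero                               ∎
  where
  open ≡-Reasoning
  open CommutativeRing ℤ[x n ] using (0#; 1#)
  ⟦_⟧ = evaluate n (a ∘ suc)
  module ⟦⟧ = RingMorphisms.IsRingHomomorphism (evaluate-isRingHom n (a ∘ suc))
  open PolynomialEvaluation ℤ[x n ] +-*-commutativeRing (evaluate-isRingHom n (a ∘ suc)) (a zero)
evaluate-var {suc n} a (suc i) = trans
  (PolynomialEvaluation.eval-∷[] ℤ[x n ] +-*-commutativeRing (evaluate-isRingHom n (a ∘ suc)) (a zero) (var i))
  (evaluate-var (a ∘ suc) i)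

-- Edges and induced paths make critical ideals trivial.

adjacent⇒edges≡1 : {G : Graph (Fin n)} → Simple G → ∀ {u v} → Adjacent G u v → edges G u v ≡ 1
adjacent⇒edges≡1 simple {u} {v} u~v = ℕₚ.≤-antisym (Simple.noParallel simple u v) (ℕₚ.n≢0⇒n>0 u~v)

module _ (G : Graph (Fin n)) (simple : Simple G) where

  open CommutativeRing ℤ[x n ] renaming (refl to ≈-refl; sym to ≈-sym; trans to ≈-trans)
  open import Algebra.Properties.Ring ring
  open import Relation.Binary.Reasoning.Setoid setoid
  open DeterminantProperties ℤ[x n ]
  open LinearAlgebra ℤ[x n ] using (minor; ⟨1⟩)
  open Simple simple

  private L = laplacian G

  edges≡0⇒L≈0 : ∀ {u v} → u ≢ v → edges G u v ≡ 0 → L u v ≈ 0#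
  edges≡0⇒L≈0 {u} {v} u≢v e with u ≟ v
  ... | yes u≡v = contradiction u≡v u≢v
  ... | no  _   rewrite e = const-0 n

  adjacent⇒L≈-1 : ∀ {u v} → Adjacent G u v → L u v ≈ - 1#
  adjacent⇒L≈-1 {u} {v} u~v with u ≟ v
  ... | yes refl = contradiction (loopless u) u~v
  ... | no  _    rewrite adjacent⇒edges≡1 simple u~v = const--1 n

  -1*-1≈1 : - 1# * - 1# ≈ 1#
  -1*-1≈1 = ≈-trans (-1*x≈-x _) (-‿involutive 1#)

  adjacent⇒I₁≐⟨1⟩ : ∀ {u v} → Adjacent G u v → criticalIdeal G 1 ≐ ⟨1⟩
  adjacent⇒I₁≐⟨1⟩ {u} {v} u~v = ⟨⟩≐⟨1⟩ (minor L) (choice₁ u , choice₁ v) (- 1#)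
    (≈-trans (*-congˡ (≈-trans (minor-choice₁ L u v) (adjacent⇒L≈-1 u~v))) -1*-1≈1)

  -- In the block on rows `f 0F`, `f 1F` and columns `f 1F`, `f 2F`, the only indeterminate is the
  -- entry at (`f 1F`, `f 1F`). It is multiplied by the 0 of the non-adjacent ends, and the other
  -- product is 1.
  P₃⇒I₂≐⟨1⟩ : path 3 ↪ G → criticalIdeal G 2 ≐ ⟨1⟩
  P₃⇒I₂≐⟨1⟩ (f , f-inj , f-edges)
    -- An embedding need not be increasing, so the sorted minor is this difference only up to the
    -- sign `q`.
    with j , q , q*minor ← minor₂ L {f 0F} {f 1F} {f 1F} {f 2F}
           ((λ ()) ∘ f-inj) ((λ ()) ∘ f-inj)
    = ⟨⟩≐⟨1⟩ (minor L) j q (begin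
      q * minor L j
        ≈⟨ q*minor ⟩
      L (f 0F) (f 1F) * L (f 1F) (f 2F) - L (f 0F) (f 2F) * L (f 1F) (f 1F)
        ≈⟨ +-cong (*-cong (adjacent⇒L≈-1 (adj 0F 1F λ ())) (adjacent⇒L≈-1 (adj 1F 2F λ ())))
             (-‿cong (*-congʳ (edges≡0⇒L≈0 ((λ ()) ∘ f-inj) (f-edges 0F 2F)))) ⟩
      - 1# * - 1# - 0# * L (f 1F) (f 1F)
        ≈⟨ +-cong -1*-1≈1 (≈-trans (-‿cong (zeroˡ _)) -0#≈0#) ⟩
      1# + 0#
        ≈⟨ +-identityʳ 1# ⟩
      1# ∎)
    where
    adj : ∀ i j → edges (path 3) i j ≢ 0 → Adjacent G (f i) (f j)
    adj i j = subst (_≢ 0) (sym (f-edges i j))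

-- Conditions that exclude an induced path on three vertices.

∣S∣≤1⇒¬01⊆S : {S : Subset (2 ℕ.+ n)} → ∣ S ∣ ℕ.≤ 1 → 0F ∈ S → ¬ (1F ∈ S)
-- The two memberships force `S` to start with two `inside` entries, so its size is at least 2.
∣S∣≤1⇒¬01⊆S (s≤s ()) here (there here)

Γ≤1⇒P₃-Free : (G : Graph (Fin n)) → Γ≤ 1 G → path 3 -Free G
Γ≤1⇒P₃-Free {n} G G∈Γ≤1 P₃⊆G = go n G G∈Γ≤1 (induced⇒↪ (path 3) G P₃⊆G)
  where
  -- The case split on `n` makes the positions `0F` and `1F`, which stand for the first and second
  -- critical ideals, available; on fewer than two vertices no embedding exists.
  go : ∀ n (G : Graph (Fin n)) → Γ≤ 1 G → ¬ (path 3 ↪ G)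
  go zero          G _ (f , _) with () ← f 0F
  go (suc zero)    G _ (f , f-inj , _) with f 0F | f 1F | f-inj {0F} {1F}
  ... | 0F | 0F | inj with () ← inj refl
  go (suc (suc n)) G G∈Γ≤1 P₃↪G@(f , _ , f-edges) =
    let open Γ≤ G∈Γ≤1
        g , (S , ∈S⇔ , ∣S∣≡g) , g≤1 = coRank
    in ∣S∣≤1⇒¬01⊆S (subst (ℕ._≤ 1) (sym ∣S∣≡g) g≤1)
      (Equivalence.from (∈S⇔ 0F) (adjacent⇒I₁≐⟨1⟩ G simple {f 0F} {f 1F}
        λ e → contradiction (trans (sym (f-edges 0F 1F)) e) λ ()))
      (Equivalence.from (∈S⇔ 1F) (P₃⇒I₂≐⟨1⟩ G simple P₃↪G))

-- The ends of an induced path are distinct, hence adjacent by completeness, yet joined by 0 edges.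
Complete⇒P₃-Free : (G : Graph (Fin n)) → Complete G → path 3 -Free G
Complete⇒P₃-Free G complete P₃⊆G =
  let f , f-inj , f-edges = induced⇒↪ (path 3) G P₃⊆G
  in complete (f 0F) (f 2F) ((λ ()) ∘ f-inj) (f-edges 0F 2F)

-- Shortening walks in graphs without an induced path on three vertices.

P₃↪ : (G : Graph (Fin n)) → Simple G → ∀ {u w v} → Adjacent G u w → Adjacent G w v →
  u ≢ v → edges G u v ≡ 0 → path 3 ↪ G
P₃↪ {n} G simple {u} {w} {v} u~w w~v u≢v uv≡0 = f , f-inj , f-edges
  where
  open Simple simple

  adjacent⇒≢ : ∀ {x y} → Adjacent G x y → x ≢ y
  adjacent⇒≢ x~y refl = x~y (loopless _)

  f : Fin 3 → Fin n
  f 0F = u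
  f 1F = w
  f 2F = v

  f-inj : Injective _≡_ _≡_ f
  f-inj {0F} {0F} e = refl
  f-inj {0F} {1F} e = contradiction e (adjacent⇒≢ u~w)
  f-inj {0F} {2F} e = contradiction e u≢v
  f-inj {1F} {0F} e = contradiction (sym e) (adjacent⇒≢ u~w)
  f-inj {1F} {1F} e = refl
  f-inj {1F} {2F} e = contradiction e (adjacent⇒≢ w~v)
  f-inj {2F} {0F} e = contradiction (sym e) u≢v
  f-inj {2F} {1F} e = contradiction (sym e) (adjacent⇒≢ w~v)
  f-inj {2F} {2F} e = refl

  f-edges : ∀ i j → edges G (f i) (f j) ≡ edges (path 3) i j
  f-edges 0F 0F = loopless u
  f-edges 0F 1F = adjacent⇒edges≡1 simple u~w
  f-edges 0F 2F = uv≡0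
  f-edges 1F 0F = trans (edges-sym G w u) (f-edges 0F 1F)
  f-edges 1F 1F = loopless w
  f-edges 1F 2F = adjacent⇒edges≡1 simple w~v
  f-edges 2F 0F = trans (edges-sym G v u) uv≡0
  f-edges 2F 1F = trans (edges-sym G v w) (f-edges 1F 2F)
  f-edges 2F 2F = loopless v

-- Induction on the walk: the part after its first edge shrinks to a point or to one edge, which
-- leaves at most two edges to contract.
P₃-Free⇒walk-shortens : (G : Graph (Fin n)) → Simple G → path 3 -Free G →
  ∀ {u v} → Star (Adjacent G) u v → u ≡ v ⊎ Adjacent G u v
P₃-Free⇒walk-shortens G simple free ε = inj₁ refl
P₃-Free⇒walk-shortens G simple free {u} {v} (u~w ◅ walk)
  with P₃-Free⇒walk-shortens G simple free walk | u ≟ v | edges G u v ℕₚ.≟ 0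
... | inj₁ refl | _       | _        = inj₂ u~w
... | inj₂ _    | yes u≡v | _        = inj₁ u≡v
... | inj₂ _    | no _    | no u~v   = inj₂ u~v
-- Distinct non-adjacent ends with a common neighbour would span an induced path.
... | inj₂ w~v  | no u≢v  | yes uv≡0 =
  contradiction (↪⇒induced (path 3) G (P₃↪ G simple u~w w~v u≢v uv≡0)) free

P₃-Free⇒Complete : (G : Graph (Fin n)) → Simple G → Connected G → path 3 -Free G → Complete G
P₃-Free⇒Complete G simple connected free u v u≢v
  with P₃-Free⇒walk-shortens G simple free (Connected.walk connected u v)
... | inj₁ u≡v = contradiction u≡v u≢v
... | inj₂ u~v = u~v

-- The co-rank of complete graphs.

evaluate-laplacian : (G : Graph (Fin n)) → Simple G → Complete G →
  ∀ u v → evaluate n (λ _ → -1ℤ) (laplacian G u v) ≡ -1ℤ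
evaluate-laplacian {n} G simple complete u v with u ≟ v
... | yes refl = evaluate-var {n} _ u
... | no  u≢v  = trans (evaluate-const n _ _)
  (cong (λ e → ℤ.- (+ e)) (adjacent⇒edges≡1 simple (complete u v u≢v)))

-- Evaluation at -1 sends every minor of size `2 + i` to the determinant of a constant matrix, which
-- is 0, while 0 and 1 differ in the integers.
Complete⇒Iᵢ≢⟨1⟩ : (G : Graph (Fin n)) → Simple G → Complete G → ∀ i →
  ¬ (criticalIdeal G (2 ℕ.+ i) ≐ LinearAlgebra.⟨1⟩ ℤ[x n ])
Complete⇒Iᵢ≢⟨1⟩ {n} G simple complete i Iᵢ≐⟨1⟩ =
  contradiction (⟨⟩≐⟨1⟩⇒0≈1 (minor {i = 2 ℕ.+ i} (laplacian G)) minor≈0 Iᵢ≐⟨1⟩) λ ()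
  where
  open LinearAlgebra ℤ[x n ] using (minor)
  open DeterminantHomomorphism ℤ[x n ] +-*-commutativeRing (evaluate-isRingHom n (λ _ → -1ℤ))
  open DeterminantProperties +-*-commutativeRing using (det-constant)
  minor≈0 : ∀ j → evaluate n (λ _ → -1ℤ) (minor {i = 2 ℕ.+ i} (laplacian G) j) ≡ 0ℤ
  minor≈0 ((f , _) , (h , _)) = trans (det-homo {2 ℕ.+ i} (λ r s → laplacian G (f r) (h s)))
    (det-constant {n = i} (λ r s → evaluate n (λ _ → -1ℤ) (laplacian G (f r) (h s))) λ r s → evaluate-laplacian G simple complete (f r) (h s))

-- The only minor here is the variable itself. It is evaluated at 0 because the value -1 used for
-- larger minors is a unit.
K₁-I₁≢⟨1⟩ : (G : Graph (Fin 1)) → ¬ (criticalIdeal G 1 ≐ LinearAlgebra.⟨1⟩ ℤ[x 1 ])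
K₁-I₁≢⟨1⟩ G I₁≐⟨1⟩ =
  contradiction (⟨⟩≐⟨1⟩⇒0≈1 (minor {i = 1} (laplacian G)) minor≈0 I₁≐⟨1⟩) λ ()
  where
  open LinearAlgebra ℤ[x 1 ] using (minor)
  open DeterminantHomomorphism ℤ[x 1 ] +-*-commutativeRing (evaluate-isRingHom 1 (λ _ → 0ℤ))
  open DeterminantProperties +-*-commutativeRing using (det₁)
  L≡0 : ∀ u v → evaluate 1 (λ _ → 0ℤ) (laplacian G u v) ≡ 0ℤ
  L≡0 0F 0F = refl
  minor≈0 : ∀ j → evaluate 1 (λ _ → 0ℤ) (minor {i = 1} (laplacian G) j) ≡ 0ℤ
  minor≈0 ((f , _) , (h , _)) = trans (det-homo {1} (λ r s → laplacian G (f r) (h s)))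
    (trans (det₁ λ r s → evaluate 1 (λ _ → 0ℤ) (laplacian G (f r) (h s)))
      (L≡0 (f 0F) (h 0F)))

-- The co-rank is 0 on at most one vertex and 1 otherwise: the first critical ideal becomes trivial
-- exactly when there is an edge.
Complete⇒coRank≤1 : ∀ n (G : Graph (Fin n)) → Simple G → Complete G →
  ∃[ g ] AlgebraicCoRank G g × g ℕ.≤ 1
Complete⇒coRank≤1 zero G simple complete = 0 , (∅ , (λ ()) , refl) , z≤n
Complete⇒coRank≤1 (suc zero) G simple complete = 0 , (∅ , ∈∅⇔ , refl) , z≤n
  where
  ∈∅⇔ : ∀ i → i ∈ ∅ ⇔ criticalIdeal G (suc (toℕ i)) ≐ LinearAlgebra.⟨1⟩ ℤ[x 1 ]
  ∈∅⇔ 0F = mk⇔ (λ i∈∅ → contradiction i∈∅ ∉⊥) (λ I₁≐⟨1⟩ → contradiction I₁≐⟨1⟩ (K₁-I₁≢⟨1⟩ G))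
Complete⇒coRank≤1 n@(suc (suc k)) G simple complete =
  1 , (inside ∷ ∅ , ∈S⇔ , cong suc (∣⊥∣≡0 (suc k))) , s≤s z≤n
  where
  ∈S⇔ : ∀ i → i ∈ inside ∷ ∅ ⇔ criticalIdeal G (suc (toℕ i)) ≐ LinearAlgebra.⟨1⟩ ℤ[x n ]
  ∈S⇔ zero    = mk⇔ (λ _ → adjacent⇒I₁≐⟨1⟩ G simple (complete 0F 1F λ ())) (λ _ → here)
  -- Position `suc i` stands for the critical ideal of index `2 + toℕ i`, so the vanishing of minors
  -- of size at least 2 applies.
  ∈S⇔ (suc i) = mk⇔ (λ { (there i∈∅) → contradiction i∈∅ ∉⊥ })
    (λ Iᵢ≐⟨1⟩ → contradiction Iᵢ≐⟨1⟩ (Complete⇒Iᵢ≢⟨1⟩ G simple complete (toℕ i)))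

theorem3p3 : ∀ (n : ℕ) (G : Graph (Fin n)) → Simple G → Connected G →
    (Γ≤ 1 G ⇔ (path 3 -Free G)) × ((path 3 -Free G) ⇔ Complete G)
theorem3p3 n G simple connected =
    -- The converse passes through completeness, where the co-rank is computed.
    mk⇔ (Γ≤1⇒P₃-Free G) (λ free → record
      { simple    = simple
      ; connected = connected
      ; coRank    = Complete⇒coRank≤1 n G simple (P₃-Free⇒Complete G simple connected free)
      })
  , mk⇔ (P₃-Free⇒Complete G simple connected) (Complete⇒P₃-Free G)
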